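{- Let $G$ be a connected graph of order at least two and let $H$ be any graph. Then the corona $G\circ H$ is a hangable graph if and only if $G$ is hangable.
   Context: All graphs are finite, simple, undirected, with nonempty vertex set. For a connected graph $G=(V_G,E_G)$, $d_G(u,v)$ is the length of a shortest $u$--$v$ path. The eccentricity of $v$ is $e_G(v)=\max\{d_G(v,u): u\in V_G\}$ and the diameter is $d(G)=\max\{e_G(v): v\in V_G\}$. The periphery of a vertex $v$ is $P_G(v)=\{u\in V_G: d_G(v,u)=e_G(v)\}$; the periphery of $G$ is $P(G)=\{v\in V_G: e_G(v)=d(G)\}$. A connected graph $G$ is hangable if $P_G(v)\subseteq P(G)$ for every $v\in V_G$. The corona $G\circ H$ of graphs $G$ and $H$ is the graph with vertex set $V_G\cup(V_G\times V_H)$ (disjoint union) and edge set $E_G\cup\bigcup_{v\in V_G}\{v(v,x): x\in V_H\}\cup\bigcup_{v\in V_G}\{(v,x)(v,y): xy\in E_H\}$. -}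

module Defs where

open import Data.Fin.Base using (Fin)
open import Data.Fin.Properties using (any?; inj⇒≟; +↔⊎; *↔×)
open import Data.List.Base using (List; []; _∷_; map; tabulate)
open import Data.List.Extrema.Nat using (max)
open import Data.List.Membership.Propositional using (_∈_)
open import Data.List.Relation.Unary.All.Properties using (¬Any⇒All¬)
open import Data.List.Relation.Unary.AllPairs using ([]; _∷_)
open import Data.List.Relation.Unary.All using ([])
open import Data.List.Relation.Unary.Any using (here; there)
import Data.List.Membership.DecPropositional as DecMembership
open import Data.List.Relation.Unary.Unique.Propositional using (Unique)
open import Data.Nat.Base using (ℕ; zero; suc; _+_; _*_; _≤_; z≤n; s≤s; NonZero; >-nonZero; >-nonZero⁻¹)
open import Data.Nat.Properties using (≤-trans; ≤-refl; m≤m+n; m≤n⇒m≤1+n)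
open import Data.Product.Base using (Σ-syntax; ∃; _×_; _,_; proj₁; proj₂)
open import Data.Product.Function.NonDependent.Propositional using (_×-↔_)
open import Data.Sum.Base using (_⊎_; inj₁; inj₂)
open import Data.Sum.Function.Propositional using (_⊎-↔_)
open import Function.Base using (_∘_)
open import Function.Bundles using (_↔_; Inverse)
open import Function.Properties.Inverse using (↔-sym; ↔-trans; Inverse⇒Injection)
open import Level using (0ℓ)
open import Relation.Binary.Construct.Closure.ReflexiveTransitive using (Star; ε; _◅_)
open import Relation.Binary.Core using (Rel)
open import Relation.Binary.Definitions using (Decidable; DecidableEquality; Symmetric; Irreflexive)
open import Relation.Binary.PropositionalEquality.Core using (_≡_; refl; sym; subst)
open import Relation.Nullary.Decidable.Core using (Dec; yes; no; map′; _×-dec_)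
open import Relation.Nullary.Negation.Core using (contradiction)
open import Relation.Unary using (Pred; _⊆_)

-- E u v is used only as a proposition: having several proofs of it does not
-- mean having parallel edges.
record Graph : Set₁ where
  field
    V        : Set
    order    : ℕ
    finite   : V ↔ Fin order
    nonEmpty : NonZero order
    E        : Rel V 0ℓ
    E?       : Decidable E
    E-sym    : Symmetric E
    E-irrefl : Irreflexive _≡_ E

  _≟_ : DecidableEquality V
  _≟_ = inj⇒≟ (Inverse⇒Injection finite)

  vertices : List V
  vertices = tabulate (Inverse.from finite)

  Walk : V → V → Set
  Walk = Star E

  walkLength : ∀ {u v} → Walk u v → ℕ
  walkLength ε       = 0
  walkLength (_ ◅ w) = suc (walkLength w)

  visited : ∀ {u v} → Walk u v → List V
  visited {u} ε       = u ∷ []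
  visited {u} (_ ◅ w) = u ∷ visited w

  Path : V → V → Set
  Path u v = Σ[ w ∈ Walk u v ] Unique (visited w)

  length : ∀ {u v} → Path u v → ℕ
  length (w , _) = walkLength w

  IsShortest : ∀ {u v} → Path u v → Set
  IsShortest {u} {v} p = (q : Path u v) → length p ≤ length q

  Connected : Set
  Connected = ∀ u v → Path u v

-- Shortest paths exist: take a walk of least length and remove its repeated
-- vertices.
module _ (G : Graph) where
  open Graph G
  open DecMembership _≟_ using (_∈?_)

  anyVertex? : {Q : V → Set} → (∀ v → Dec (Q v)) → Dec (∃ Q)
  anyVertex? {Q} Q? = map′
    (λ (i , q) → Inverse.from finite i , q)
    (λ (v , q) → Inverse.to finite v ,
                 subst Q (sym (Inverse.strictlyInverseʳ finite v)) q)
    (any? (Q? ∘ Inverse.from finite))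

  WalkOfLength : V → V → ℕ → Set
  WalkOfLength u v k = Σ[ w ∈ Walk u v ] walkLength w ≡ k

  walkOfLength? : ∀ u v k → Dec (WalkOfLength u v k)
  walkOfLength? u v zero    = map′ (λ { refl → ε , refl }) (λ { (ε , _) → refl }) (u ≟ v)
  walkOfLength? u v (suc k) = map′
    (λ { (_ , e , w , refl) → e ◅ w , refl })
    (λ { (e ◅ w , refl) → _ , e , w , refl })
    (anyVertex? λ x → E? u x ×-dec walkOfLength? x v k)

  suffix : ∀ {u v x} (p : Path u v) → x ∈ visited (proj₁ p) →
           Σ[ q ∈ Path x v ] length q ≤ length p
  suffix p@(ε , _)           (here refl) = p , ≤-refl
  suffix p@(_ ◅ _ , _)       (here refl) = p , ≤-refl
  suffix (_ ◅ w , _ ∷ uniq)  (there x∈w) with suffix (w , uniq) x∈w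
  ... | q , q≤w = q , m≤n⇒m≤1+n q≤w

  toPath : ∀ {u v} (w : Walk u v) → Σ[ p ∈ Path u v ] length p ≤ walkLength w
  toPath ε = (ε , [] ∷ []) , z≤n
  toPath {u} (e ◅ w) with toPath w
  ... | p@(w′ , uniq) , p≤w with u ∈? visited w′
  ...   | no  u∉w′ = (e ◅ w′ , ¬Any⇒All¬ _ u∉w′ ∷ uniq) , s≤s p≤w
  ...   | yes u∈w′ with suffix p u∈w′
  ...     | q , q≤p = q , m≤n⇒m≤1+n (≤-trans q≤p p≤w)

  least : {Q : ℕ → Set} → (∀ k → Dec (Q k)) → ∀ n → Q n →
          Σ[ m ∈ ℕ ] Q m × (∀ k → Q k → m ≤ k)
  least Q? zero q = zero , q , λ _ _ → z≤n
  least {Q} Q? (suc n) q with Q? zero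
  ... | yes q₀ = zero , q₀ , λ _ _ → z≤n
  ... | no ¬q₀ with least {Q ∘ suc} (Q? ∘ suc) n q
  ...   | m , qm , m≤ = suc m , qm , λ where
          zero    q₀ → contradiction q₀ ¬q₀
          (suc k) qk → s≤s (m≤ k qk)

  shortestPath : Connected → ∀ u v → Σ[ p ∈ Path u v ] IsShortest p
  shortestPath conn u v
    with least (walkOfLength? u v) _ (proj₁ (conn u v) , refl)
  ... | _ , (w , refl) , w≤ with toPath w
  ...   | p , p≤w = p , λ (w′ , _) → ≤-trans p≤w (w≤ _ (w′ , refl))

module Metric (G : Graph) (conn : Graph.Connected G) where
  open Graph G

  d : V → V → ℕ
  d u v = length (proj₁ (shortestPath G conn u v))

  -- The list of vertices is nonempty, so the base value 0 of max does not
  -- affect the maximum; likewise for the diameter.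
  ecc : V → ℕ
  ecc v = max 0 (map (d v) vertices)

  diameter : ℕ
  diameter = max 0 (map ecc vertices)

  peripheryOf : V → Pred V 0ℓ
  peripheryOf v u = d v u ≡ ecc v

  periphery : Pred V 0ℓ
  periphery v = ecc v ≡ diameter

Hangable : Graph → Set
Hangable G = Σ[ conn ∈ Graph.Connected G ]
  (let open Metric G conn in ∀ v → peripheryOf v ⊆ periphery)

module _ (G H : Graph) where
  private
    module G = Graph G
    module H = Graph H

  CoronaV : Set
  CoronaV = G.V ⊎ (G.V × H.V)

  -- down and up are the two orientations of the edge {v, (v , x)}.
  data CoronaE : Rel CoronaV 0ℓ where
    base  : ∀ {u v} → G.E u v → CoronaE (inj₁ u) (inj₁ v)
    down  : ∀ {v x} → CoronaE (inj₁ v) (inj₂ (v , x))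
    up    : ∀ {v x} → CoronaE (inj₂ (v , x)) (inj₁ v)
    copy  : ∀ {v x y} → H.E x y → CoronaE (inj₂ (v , x)) (inj₂ (v , y))

  coronaE? : Decidable CoronaE
  coronaE? (inj₁ u) (inj₁ v) = map′ base (λ { (base e) → e }) (G.E? u v)
  coronaE? (inj₁ u) (inj₂ (v , x)) = map′ (λ { refl → down }) (λ { down → refl }) (u G.≟ v)
  coronaE? (inj₂ (u , x)) (inj₁ v) = map′ (λ { refl → up }) (λ { up → refl }) (u G.≟ v)
  coronaE? (inj₂ (u , x)) (inj₂ (v , y)) = map′
    (λ { (refl , e) → copy e }) (λ { (copy e) → refl , e })
    ((u G.≟ v) ×-dec H.E? x y)

  coronaE-sym : Symmetric CoronaE
  coronaE-sym (base e) = base (G.E-sym e)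
  coronaE-sym down     = up
  coronaE-sym up       = down
  coronaE-sym (copy e) = copy (H.E-sym e)

  coronaE-irrefl : Irreflexive _≡_ CoronaE
  coronaE-irrefl refl (base e) = G.E-irrefl refl e
  coronaE-irrefl refl (copy e) = H.E-irrefl refl e

  corona : Graph
  corona = record
    { V        = CoronaV
    ; order    = G.order + G.order * H.order
    ; finite   = ↔-trans (G.finite ⊎-↔ ↔-trans (G.finite ×-↔ H.finite) (↔-sym *↔×)) (↔-sym +↔⊎)
    ; nonEmpty = >-nonZero (≤-trans (>-nonZero⁻¹ G.order {{G.nonEmpty}}) (m≤m+n _ _))
    ; E        = CoronaE
    ; E?       = coronaE?
    ; E-sym    = coronaE-sym
    ; E-irrefl = coronaE-irrefl
    }

{-# OPTIONS --safe #-}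

-- Let π send v and every (v , x) to v, and let height be 0 on G and 1 on the
-- copies of H.  A walk of the corona projects to G, and spends one further step
-- at each end lying in a copy unless it stays inside that copy.  Hence
-- d a b ≤ height a + d (π a) (π b) + height b, with equality when π a ≠ π b or
-- height a = 0.  Since G has at least two vertices, it follows that
-- ecc a = height a + ecc (π a) + 1, and the diameter grows by 2.  So all vertices
-- in the periphery of the corona, or of one of its vertices a, lie in the copies,
-- and are those over the periphery of G, respectively of π a.
module Submission where

open import Defs
open import Data.Fin.Base using (Fin; zero; suc; fromℕ<)
open import Data.List.Base using (map)
open import Data.List.Extrema.Nat using (max; xs≤max; max≤v⁺; argmax-sel)
open import Data.List.Membership.Propositional using (_∈_)
open import Data.List.Membership.Propositional.Properties
  using (∈-map⁺; ∈-map⁻; ∈-tabulate⁺)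
import Data.List.Relation.Unary.All as All
open import Data.Nat.Base using (ℕ; suc; _+_; _≤_; _<_; z≤n; s≤s; s≤s⁻¹; >-nonZero⁻¹)
open import Data.Nat.Properties
open import Data.Product.Base using (Σ-syntax; ∃; ∃₂; _×_; _,_; proj₁; proj₂)
open import Data.Sum.Base using (_⊎_; inj₁; inj₂)
open import Function.Base using (id)
open import Function.Bundles using (_⇔_; mk⇔; Inverse)
open import Relation.Binary.Construct.Closure.ReflexiveTransitive using (ε; _◅_)
open import Relation.Binary.PropositionalEquality
  using (_≡_; _≢_; refl; sym; trans; cong; subst)
open import Relation.Nullary.Negation using (contradiction)

distinctPair : ∀ {n} → 2 ≤ n → ∃₂ λ (i j : Fin n) → i ≢ j
distinctPair (s≤s (s≤s _)) = zero , suc zero , λ ()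

module Maximum (G : Graph) where
  open Graph G

  vertex : V
  vertex = Inverse.from finite (fromℕ< (>-nonZero⁻¹ order {{nonEmpty}}))

  ∈-vertices : ∀ v → v ∈ vertices
  ∈-vertices v = subst (_∈ vertices) (Inverse.strictlyInverseʳ finite v)
    (∈-tabulate⁺ (Inverse.to finite v))

  maximum : (V → ℕ) → ℕ
  maximum f = max 0 (map f vertices)

  ≤-maximum : ∀ f v → f v ≤ maximum f
  ≤-maximum f v = All.lookup (xs≤max 0 (map f vertices)) (∈-map⁺ f (∈-vertices v))

  maximum-≤ : ∀ f {m} → (∀ v → f v ≤ m) → maximum f ≤ m
  maximum-≤ f {m} f≤m = max≤v⁺ z≤n (All.tabulate bound)
    where
    bound : ∀ {k} → k ∈ map f vertices → k ≤ m
    bound k∈ with ∈-map⁻ f k∈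
    ... | v , _ , refl = f≤m v

  maximum-attained : ∀ f → ∃ λ v → f v ≡ maximum f
  maximum-attained f with argmax-sel id 0 (map f vertices)
  -- Here the maximum is the default value `0` of `max`, so every value is `0` and any vertex
  -- attains it.
  ... | inj₁ max≡0 = vertex ,
    ≤-antisym (≤-maximum f vertex) (≤-trans (≤-reflexive max≡0) z≤n)
  ... | inj₂ max∈ with ∈-map⁻ f max∈
  ...   | v , _ , max≡fv = v , sym max≡fv

  maximum-unique : ∀ f {m} → (∀ v → f v ≤ m) → (∃ λ v → f v ≡ m) → maximum f ≡ m
  maximum-unique f f≤m (v , refl) = ≤-antisym (maximum-≤ f f≤m) (≤-maximum f v)

module MetricProperties (G : Graph) (conn : Graph.Connected G) where
  open Graph G
  open Metric G conn
  open Maximum G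

  -- `shortestPath` is minimal among paths only, so the walk is first shortened to a path.
  d-≤-walk : ∀ {u v} (w : Walk u v) → d u v ≤ walkLength w
  d-≤-walk {u} {v} w =
    let p , p≤w = toPath G w in ≤-trans (proj₂ (shortestPath G conn u v) p) p≤w

  geodesic : ∀ u v → Σ[ w ∈ Walk u v ] walkLength w ≡ d u v
  geodesic u v = proj₁ (proj₁ (shortestPath G conn u v)) , refl

  d≡0⇒≡ : ∀ u v → d u v ≡ 0 → u ≡ v
  d≡0⇒≡ u v d≡0 with geodesic u v
  ... | ε , _ = refl
  ... | _ ◅ _ , 1+k≡d = contradiction (trans 1+k≡d d≡0) λ ()

  -- With eccentricity `0` every vertex would be at distance `0` from `v`, hence equal to it, and
  -- two distinct indices would coincide.
  ecc≢0 : 2 ≤ order → ∀ v → ecc v ≢ 0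
  ecc≢0 2≤n v ecc≡0 with distinctPair 2≤n
  ... | i , j , i≢j = i≢j (trans (sym (to-v i)) (to-v j))
    where
    to-v : ∀ i → Inverse.to finite v ≡ i
    to-v i = trans
      (cong (Inverse.to finite) (d≡0⇒≡ v (Inverse.from finite i)
        (n≤0⇒n≡0 (≤-trans (≤-maximum (d v) _) (≤-reflexive ecc≡0)))))
      (Inverse.strictlyInverseˡ finite i)

module CoronaWalks (G H : Graph) where
  private
    module G = Graph G
    module H = Graph H
    module C = Graph (corona G H)

  π : C.V → G.V
  π (inj₁ v)       = v
  π (inj₂ (v , _)) = v

  height : C.V → ℕ
  height (inj₁ _) = 0
  height (inj₂ _) = 1

  height≤1 : ∀ a → height a ≤ 1
  height≤1 (inj₁ _) = z≤n
  height≤1 (inj₂ _) = ≤-refl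

  liftFromBase : ∀ {u} b (w : G.Walk u (π b)) →
    Σ[ w′ ∈ C.Walk (inj₁ u) b ] C.walkLength w′ ≡ G.walkLength w + height b
  liftFromBase (inj₁ _) ε = ε , refl
  liftFromBase (inj₂ _) ε = down ◅ ε , refl
  liftFromBase b (e ◅ w) =
    let w′ , eq = liftFromBase b w in base e ◅ w′ , cong suc eq

  lift : ∀ a b (w : G.Walk (π a) (π b)) →
    Σ[ w′ ∈ C.Walk a b ] C.walkLength w′ ≡ height a + (G.walkLength w + height b)
  lift (inj₁ _) b w = liftFromBase b w
  lift (inj₂ _) b w = let w′ , eq = liftFromBase b w in up ◅ w′ , cong suc eq

  mutual
    projectFromBase : ∀ {u b} (w : C.Walk (inj₁ u) b) →
      Σ[ w′ ∈ G.Walk u (π b) ] G.walkLength w′ + height b ≤ C.walkLength w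
    projectFromBase ε = ε , z≤n
    projectFromBase (base e ◅ w) =
      let w′ , w′≤w = projectFromBase w in e ◅ w′ , s≤s w′≤w
    projectFromBase {b = b} (down ◅ w) with projectFromCopy w
    -- Now `b` lies over the starting vertex, and the `down` step alone pays for `height b`.
    ... | inj₁ refl        = ε , ≤-trans (height≤1 b) (s≤s z≤n)
    ... | inj₂ (w′ , w′<w) = w′ , m≤n⇒m≤1+n (<⇒≤ w′<w)

    -- The first alternative is returned for walks that never leave the copy. Any other walk goes up
    -- at some point, and that step makes the inequality strict.
    projectFromCopy : ∀ {v x b} (w : C.Walk (inj₂ (v , x)) b) →
      v ≡ π b ⊎ Σ[ w′ ∈ G.Walk v (π b) ] G.walkLength w′ + height b < C.walkLength w
    projectFromCopy ε = inj₁ refl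
    projectFromCopy (up ◅ w) =
      let w′ , w′≤w = projectFromBase w in inj₂ (w′ , s≤s w′≤w)
    projectFromCopy (copy _ ◅ w) with projectFromCopy w
    ... | inj₁ v≡πb         = inj₁ v≡πb
    ... | inj₂ (w′ , w′<w) = inj₂ (w′ , m≤n⇒m≤1+n w′<w)

  corona-connected : G.Connected → C.Connected
  corona-connected conn a b =
    proj₁ (toPath (corona G H) (proj₁ (lift a b (proj₁ (conn (π a) (π b))))))

module CoronaMetric (G H : Graph) (2≤n : 2 ≤ Graph.order G)
  (connG : Graph.Connected G) (connC : Graph.Connected (corona G H)) where
  private
    module G where
      open Graph G public
      open Metric G connG public
      open Maximum G public
      open MetricProperties G connG public
    module C where
      open Graph (corona G H) public
      open Metric (corona G H) connC public
      open Maximum (corona G H) public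
      open MetricProperties (corona G H) connC public
  open CoronaWalks G H

  above : G.V → C.V
  above v = inj₂ (v , Maximum.vertex H)

  d-≤ : ∀ a b → C.d a b ≤ height a + (G.d (π a) (π b) + height b)
  d-≤ a b with lift a b (proj₁ (G.geodesic (π a) (π b)))
  ... | w , eq = ≤-trans (C.d-≤-walk w) (≤-reflexive eq)

  d-fromBase-≥ : ∀ u b → G.d u (π b) + height b ≤ C.d (inj₁ u) b
  d-fromBase-≥ u b =
    let w′ , w′≤w = projectFromBase (proj₁ (C.geodesic (inj₁ u) b))
    in ≤-trans (+-monoˡ-≤ (height b) (G.d-≤-walk w′)) w′≤w

  -- Two vertices of one copy can be closer than the bound `2`; a nonzero base distance forces a
  -- walk out of the copy.
  d-≥ : ∀ a b → G.d (π a) (π b) ≢ 0 →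
    height a + (G.d (π a) (π b) + height b) ≤ C.d a b
  d-≥ (inj₁ u) b _ = d-fromBase-≥ u b
  d-≥ a@(inj₂ (v , x)) b d≢0 with projectFromCopy (proj₁ (C.geodesic a b))
  ... | inj₁ refl = contradiction (n≤0⇒n≡0 (G.d-≤-walk ε)) d≢0
  ... | inj₂ (w′ , w′<w) = ≤-trans (s≤s (+-monoˡ-≤ (height b) (G.d-≤-walk w′))) w′<w

  ecc-corona : ∀ a → C.ecc a ≡ height a + suc (G.ecc (π a))
  ecc-corona a = C.maximum-unique (C.d a) bound (above u , attained)
    where
    open ≤-Reasoning
    farthest = G.maximum-attained (G.d (π a))
    u = proj₁ farthest
    du≡ecc : G.d (π a) u ≡ G.ecc (π a)
    du≡ecc = proj₂ farthest

    bound : ∀ b → C.d a b ≤ height a + suc (G.ecc (π a))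
    bound b = begin
      C.d a b                                    ≤⟨ d-≤ a b ⟩
      height a + (G.d (π a) (π b) + height b)    ≤⟨ +-monoʳ-≤ (height a)
        (+-mono-≤ (G.≤-maximum (G.d (π a)) (π b)) (height≤1 b)) ⟩
      height a + (G.ecc (π a) + 1)               ≡⟨ cong (height a +_) (+-comm _ 1) ⟩
      height a + suc (G.ecc (π a))               ∎

    attained : C.d a (above u) ≡ height a + suc (G.ecc (π a))
    attained = ≤-antisym (bound (above u)) (begin
      height a + suc (G.ecc (π a))               ≡⟨ cong (λ k → height a + suc k) du≡ecc ⟨
      height a + suc (G.d (π a) u)               ≡⟨ cong (height a +_) (+-comm _ 1) ⟨
      height a + (G.d (π a) u + 1)               ≤⟨ d-≥ a (above u)
        -- A farthest vertex `u` differs from `π a` because `G` has at least two vertices.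
        (λ d≡0 → G.ecc≢0 2≤n (π a) (trans (sym du≡ecc) d≡0)) ⟩
      C.d a (above u)                            ∎)

  -- One unit is the `height` of the centre, the other the final step into a copy; both occur for a
  -- centre above a peripheral vertex of `G`.
  diameter-corona : C.diameter ≡ 2 + G.diameter
  diameter-corona = C.maximum-unique C.ecc bound (above u , attained)
    where
    peripheral = G.maximum-attained G.ecc
    u = proj₁ peripheral

    bound : ∀ a → C.ecc a ≤ 2 + G.diameter
    bound a = ≤-trans (≤-reflexive (ecc-corona a))
      (+-mono-≤ (height≤1 a) (s≤s (G.≤-maximum G.ecc (π a))))

    attained : C.ecc (above u) ≡ 2 + G.diameter
    attained = trans (ecc-corona (above u)) (cong (2 +_) (proj₂ peripheral))

  -- Starting from a base vertex, the upper and lower bounds on distance agree even when `u` and `v`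
  -- coincide.
  peripheryOf-above : ∀ {u v} → G.peripheryOf v u → C.peripheryOf (inj₁ v) (above u)
  peripheryOf-above {u} {v} d≡ecc = trans
    (≤-antisym (d-≤ (inj₁ v) (above u)) (d-fromBase-≥ v (above u)))
    (trans (+-comm _ 1) (trans (cong suc d≡ecc) (sym (ecc-corona (inj₁ v)))))

  periphery-above⁻ : ∀ {u} → C.periphery (above u) → G.periphery u
  periphery-above⁻ {u} ecc≡diam = +-cancelˡ-≡ 2 _ _
    (trans (sym (ecc-corona (above u))) (trans ecc≡diam diameter-corona))

  -- Cancelling `height a` leaves `G.ecc (π a) + 1` bounded by `G.d (π a) (π b) + height b`. The
  -- distance is at most the eccentricity and the height at most `1`, so both are extremal.
  peripheryOf-corona : ∀ a b → C.peripheryOf a b →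
    height b ≡ 1 × G.peripheryOf (π a) (π b)
  peripheryOf-corona a b d≡ecc = onCopy b (+-cancelˡ-≤ (height a) _ _
    (≤-trans (≤-reflexive (trans (sym (ecc-corona a)) (sym d≡ecc))) (d-≤ a b)))
    where
    onCopy : ∀ b → G.ecc (π a) < G.d (π a) (π b) + height b →
      height b ≡ 1 × G.peripheryOf (π a) (π b)
    onCopy (inj₁ u) ecc<d = contradiction
      (<-≤-trans ecc<d (≤-trans (≤-reflexive (+-identityʳ _)) (G.≤-maximum (G.d (π a)) u)))
      (n≮n _)
    onCopy (inj₂ (u , _)) ecc<d+1 = refl ,
      ≤-antisym (G.≤-maximum (G.d (π a)) u)
                (s≤s⁻¹ (≤-trans ecc<d+1 (≤-reflexive (+-comm _ 1))))

  periphery-corona⁺ : ∀ b → height b ≡ 1 → G.periphery (π b) → C.periphery b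
  periphery-corona⁺ b@(inj₂ _) _ ecc≡diam =
    trans (ecc-corona b) (trans (cong (2 +_) ecc≡diam) (sym diameter-corona))

theorem2 : (G H : Graph) → Graph.Connected G → 2 ≤ Graph.order G →
    Hangable (corona G H) ⇔ Hangable G
theorem2 G H conn 2≤n = mk⇔ to from
  where
  to : Hangable (corona G H) → Hangable G
  to (connC , hangable) = conn , λ v u∈Pv →
    periphery-above⁻ (hangable (inj₁ v) (peripheryOf-above u∈Pv))
    where open CoronaMetric G H 2≤n conn connC

  from : Hangable G → Hangable (corona G H)
  -- `Metric` depends on the connectivity proof, so distances in `G` are taken with the `connG` that
  -- comes with hangability.
  from (connG , hangable) = connC , λ a {b} b∈Pa →
    let h≡1 , πb∈Pπa = peripheryOf-corona a b b∈Pa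
    in periphery-corona⁺ b h≡1 (hangable (π a) πb∈Pπa)
    where
    open CoronaWalks G H
    connC = corona-connected connG
    open CoronaMetric G H 2≤n connG connC
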